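{- If $T\subseteq\mathbb{Z}^n$ is an integer tiling with $\Upsilon_n$, where $n$ is odd, then $n=2^t-1$ for some $t>0$.
   Context: $\Upsilon_n=\{U\in\mathbb{Z}^n:\sum_i|x_i-u_i|\le1\text{ for some }X\in\{ -1,0\}^n\}$. A set $T\subseteq\mathbb{Z}^n$ is an integer tiling with $\Upsilon_n$ if the translates $X+\Upsilon_n$, $X\in T$, partition $\mathbb{Z}^n$. -}

module Defs where

open import Data.Nat using (ℕ; _≤_; _+_)
open import Data.Integer using (ℤ; ∣_∣; _-_; 0ℤ; -1ℤ)
import Data.Integer as ℤ
open import Data.Fin using (Fin)
open import Data.Product using (Σ; ∃; _×_)
open import Data.Sum using (_⊎_)
open import Data.Vec.Functional using (Vector; foldr)
open import Relation.Binary.PropositionalEquality using (_≡_)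

ℤ^ : ℕ → Set
ℤ^ n = Vector ℤ n

dist₁ : ∀ {n} → ℤ^ n → ℤ^ n → ℕ
dist₁ x u = foldr _+_ 0 (λ i → ∣ x i - u i ∣)

IsZeroMinusOneVec : ∀ {n} → ℤ^ n → Set
IsZeroMinusOneVec x = ∀ i → (x i ≡ 0ℤ) ⊎ (x i ≡ -1ℤ)

Υ : (n : ℕ) → ℤ^ n → Set
Υ n u = Σ (ℤ^ n) λ x → IsZeroMinusOneVec x × (dist₁ x u ≤ 1)

_⊖_ : ∀ {n} → ℤ^ n → ℤ^ n → ℤ^ n
(z ⊖ x) i = z i - x i

IsIntegerTiling : (n : ℕ) → (ℤ^ n → Set) → Set
IsIntegerTiling n T =
  (∀ z → Σ (ℤ^ n) λ x → T x × Υ n (z ⊖ x))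
  × (∀ z x y → T x → T y → Υ n (z ⊖ x) → Υ n (z ⊖ y) → x ≡ y)

{-# OPTIONS --safe #-}

-- Let S be the union of the cubes x + {−1,0}ⁿ, x ∈ T. Tiling means that every point outside S
-- has exactly one neighbour in S, while a point of S has exactly one neighbour in S along each
-- axis. For z ∈ S let oᵢ be the unit vector along axis i that leaves S. Then z + oᵢ + oⱼ ∉ S, and
-- its unique neighbour in S is z + oᵢ + oⱼ + oₖ for some k. This makes i ∙ j = k a totally
-- symmetric quasigroup on the n axes, so for odd n the squaring map i ↦ i ∙ i is injective.
--
-- Suppose i ∙ i ≠ i at some z ∈ S. This persists at all points of the face of the cube of z on
-- which oᵢ is constant. Colour such a point by h = i ∙ i, and walk along the face by crossing the
-- cube along axis h at each step. Injectivity of squaring shows that h changes at every step, and a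
-- colour once left never recurs, which is absurd. Hence z + 3oᵢ ∈ S for all z ∈ S and all i, so S
-- is invariant under 4ℤⁿ and exactly one of z, z + 2e₁, …, z + 2eₙ lies in S, for every z. So S
-- meets {0,2}ⁿ in a perfect 1-error-correcting code, whence n + 1 divides 2ⁿ.
module Submission where

open import Defs
open import Algebra.Properties.CommutativeSemigroup using (interchange)
open import Data.Bool using (Bool; true; false; if_then_else_; not)
open import Data.Fin using (Fin; zero; suc; _<?_)
open import Data.Fin.Properties as Fin
  using (ℕ→Fin-notInjective; _≟_; <-cmp; any?; all?; injective⇒≤; punchOut-injective)
open import Data.Fin.Permutation using (permutation)
open import Data.Integer as ℤ using (ℤ; 0ℤ; -1ℤ; ∣_∣; _-_)
import Data.Integer.Properties as ℤ
open import Data.Integer.Tactic.RingSolver using (solve-∀)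
open import Data.Nat as ℕ using (ℕ; zero; suc; _+_; _*_; _^_; _∸_; _≤_; _<_; z≤n; s≤s)
import Data.Nat.Properties as ℕ
open import Data.Nat.Divisibility using (_∣_; divides; ∣1⇒≡1)
open import Data.Nat.GeneralisedArithmetic using (fold; fold-+)
open import Data.Nat.Primality using (euclidsLemma; prime[2])
open import Data.Product using (∃; _×_; _,_; proj₁; proj₂)
open import Data.Sign as Sign using (Sign; opposite)
open import Data.Sign.Properties using (s≢opposite[s]; opposite-involutive)
open import Data.Sum as Sum using (_⊎_; inj₁; inj₂)
open import Data.Vec as Vec using (Vec; []; _∷_; lookup; updateAt)
open import Data.Vec.Properties
  using (lookup∘updateAt; lookup∘updateAt′; updateAt-commutes; updateAt-updateAt;
         updateAt-id-local; updateAt-cong; map-updateAt)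
open import Algebra.Properties.CommutativeMonoid.Sum ℕ.+-0-commutativeMonoid
  using (sum; ∑-distrib-+; ∑-permute; sum-cong-≗; sum-replicate-zero)
open import Function using (_∘_)
open import Function.Definitions using (Injective)
open import Relation.Binary using (tri<; tri≈; tri>)
open import Relation.Nullary using (¬_; Dec; yes; no; does; contradiction)
open import Relation.Nullary.Decidable using (dec-true; dec-false; _⊎-dec_)
open import Relation.Binary.PropositionalEquality

open ≡-Reasoning

-- Colourings along orbits.

iterates-distinct : ∀ {A : Set} {n} (P : A → Set) (h : A → Fin n) (s : A → A) →
  (∀ {a} → P a → P (s a)) → (∀ {a} m → P a → h (fold (s a) s m) ≢ h a) →
  ∀ {a} → ¬ P a
iterates-distinct P h s P-s fresh {a} Pa = ℕ→Fin-notInjective (h ∘ orbit) inj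
  where
  orbit : ℕ → _
  orbit = fold a s

  P-orbit : ∀ m → P (orbit m)
  P-orbit zero    = Pa
  P-orbit (suc m) = P-s (P-orbit m)

  later : ∀ {m m′} → m ℕ.< m′ → h (orbit m′) ≢ h (orbit m)
  later {m} m<m′ eq with k , refl ← ℕ.m≤n⇒∃[o]m+o≡n m<m′ =
    fresh k (P-orbit m) (trans (cong h (trans (sym (fold-+ a s k)) (cong orbit (ℕ.+-comm k (suc m))))) eq)

  inj : Injective _≡_ _≡_ (h ∘ orbit)
  inj {m} {m′} eq with ℕ.<-cmp m m′
  ... | tri< m<m′ _ _ = contradiction (sym eq) (later m<m′)
  ... | tri≈ _ refl _ = refl
  ... | tri> _ _ m′<m = contradiction eq (later m′<m)

-- With j = h a, the invariant h (t j b) ≡ j survives each further step b ↦ t (h b) b, while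
-- `moving` applied at t j b gives h b ≢ j.
no-colouring : ∀ {A : Set} {n} (P : A → Set) (t : Fin n → A → A) (h : A → Fin n) →
  (∀ {a b} → P a → P b → P (t (h a) b)) →
  (∀ {a} j → P a → t j (t j a) ≡ a) →
  (∀ {a} j k → P a → t j (t k a) ≡ t k (t j a)) →
  (∀ {a} → P a → h (t (h a) a) ≢ h a) →
  (∀ {a} → P a → h (t (h (t (h a) a)) a) ≡ h a) →
  ∀ {a} → ¬ P a
no-colouring {A} P t h P-t t-inv t-comm moving back =
  iterates-distinct P h s (λ Pa → P-t Pa Pa) fresh
  where
  s : A → A
  s a = t (h a) a

  module _ {a} (Pa : P a) where
    Q : A → Set
    Q b = P b × h (t (h a) b) ≡ h a

    return : ∀ {b} → Q b → t (h (t (h a) b)) (t (h a) b) ≡ b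
    return {b} (Pb , eq) = trans (cong (λ j → t j (t (h a) b)) eq) (t-inv (h a) Pb)

    Q⇒≢ : ∀ {b} → Q b → h b ≢ h a
    Q⇒≢ q@(Pb , eq) hb≡ha = moving (P-t Pa Pb) (trans (cong h (return q)) (trans hb≡ha (sym eq)))

    Q-s : ∀ {b} → Q b → Q (s b)
    Q-s {b} q@(Pb , eq) = P-t Pb Pb , (begin
      h (t (h a) (t (h b) b))                          ≡⟨ cong h (t-comm (h a) (h b) Pb) ⟩
      h (t (h b) u)                                    ≡⟨ cong (λ c → h (t (h c) u)) (return q) ⟨
      -- As u has colour h a, its own step leads back to b, so `back` at u says that applying t (h
      -- b) to u leaves its colour unchanged.
      h (t (h (t (h u) u)) u)                          ≡⟨ back (P-t Pa Pb) ⟩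
      h u                                              ≡⟨ eq ⟩
      h a                                              ∎)
      where
      u = t (h a) b

    Q-orbit : ∀ m → Q (fold (s a) s m)
    Q-orbit zero    = P-t Pa Pa , cong h (t-inv (h a) Pa)
    Q-orbit (suc m) = Q-s (Q-orbit m)

  fresh : ∀ {a} m → P a → h (fold (s a) s m) ≢ h a
  fresh m Pa = Q⇒≢ Pa (Q-orbit Pa m)

-- Counting, and totally symmetric quasigroups of odd order.

indicator : ∀ {P : Set} → Dec P → ℕ
indicator p? = if does p? then 1 else 0

indicator-yes : ∀ {P : Set} (p? : Dec P) → P → indicator p? ≡ 1
indicator-yes p? p = cong (λ b → if b then 1 else 0) (dec-true p? p)

indicator-no : ∀ {P : Set} (p? : Dec P) → ¬ P → indicator p? ≡ 0
indicator-no p? ¬p = cong (λ b → if b then 1 else 0) (dec-false p? ¬p)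

sum-single : ∀ {n} {f : Fin n → ℕ} {c} i → f i ≡ c → (∀ j → j ≢ i → f j ≡ 0) → sum f ≡ c
sum-single {suc n} zero fi≡c other =
  trans (cong₂ _+_ fi≡c (trans (sum-cong-≗ (λ j → other (suc j) λ ())) (sum-replicate-zero n)))
    (ℕ.+-identityʳ _)
sum-single {suc n} (suc i) fi≡c other =
  cong₂ _+_ (other zero λ ()) (sum-single i fi≡c (λ j j≢i → other (suc j) (j≢i ∘ Fin.suc-injective)))

odd≢double : ∀ k m → suc (2 * k) ≢ m + m
odd≢double k m eq = ℕ.even≢odd m k (trans (cong (m +_) (ℕ.+-identityʳ m)) (sym eq))

-- Without fixed points, f exchanges the ascents i < f i with the descents f i < i, so n would be
-- twice the number of ascents.
involution-fixes : ∀ {n} k → n ≡ suc (2 * k) → (f : Fin n → Fin n) →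
  (∀ i → f (f i) ≡ i) → ∃ λ i → f i ≡ i
involution-fixes {n} k odd f inv with any? (λ i → f i ≟ i)
... | yes fixed = fixed
... | no free = contradiction (trans (sym odd) (begin
  n                                          ≡⟨ sum-ones n ⟨
  sum {n} (λ _ → 1)                          ≡⟨ sum-cong-≗ one-side ⟨
  sum (λ i → ascent i + descent i)           ≡⟨ ∑-distrib-+ ascent descent ⟩
  sum ascent + sum descent                   ≡⟨ cong (sum ascent +_) (sum-cong-≗ λ i → cong (λ j → indicator (f i <? j)) (inv i)) ⟨
  sum ascent + sum (ascent ∘ f)              ≡⟨ cong (sum ascent +_) (∑-permute ascent (permutation f f inv inv)) ⟨
  sum ascent + sum ascent                    ∎)) (odd≢double k (sum ascent))
  where
  ascent descent : Fin n → ℕ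
  ascent  i = indicator (i <? f i)
  descent i = indicator (f i <? i)

  sum-ones : ∀ m → sum {m} (λ _ → 1) ≡ m
  sum-ones zero    = refl
  sum-ones (suc m) = cong suc (sum-ones m)

  one-side : ∀ i → ascent i + descent i ≡ 1
  one-side i with <-cmp i (f i)
  ... | tri< i<fi _ fi≮i = cong₂ _+_ (indicator-yes (i <? f i) i<fi) (indicator-no (f i <? i) fi≮i)
  ... | tri≈ _ i≡fi _    = contradiction (i , sym i≡fi) free
  ... | tri> i≮fi _ fi<i = cong₂ _+_ (indicator-no (i <? f i) i≮fi) (indicator-yes (f i <? i) fi<i)

injective⇒surjective : ∀ {n} {f : Fin n → Fin n} → Injective _≡_ _≡_ f → ∀ j → ∃ λ i → f i ≡ j
injective⇒surjective {suc n} {f} inj j with any? (λ i → f i ≟ j)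
... | yes hit = hit
... | no miss = contradiction
  (injective⇒≤ λ {i} {i′} eq → inj (punchOut-injective (avoid i) (avoid i′) eq)) ℕ.1+n≰n
  where
  avoid : ∀ i → j ≢ f i
  avoid i j≡fi = miss (i , sym j≡fi)

-- In a totally symmetric quasigroup of odd order the involution i ↦ i ∙ j has a fixed point,
-- that is, j lies on the diagonal.
square-injective : ∀ {n} k → n ≡ suc (2 * k) → (_∙_ : Fin n → Fin n → Fin n) →
  (∀ i j → i ∙ j ≡ j ∙ i) → (∀ i j → i ∙ (i ∙ j) ≡ j) →
  Injective _≡_ _≡_ (λ i → i ∙ i)
square-injective {n} k odd _∙_ comm cancel {i} {j} eq =
  conclude (injective⇒surjective root-injective i) (injective⇒surjective root-injective j) eq
  where
  fixed : ∀ j → ∃ λ i → j ∙ i ≡ i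
  fixed j = involution-fixes k odd (j ∙_) (cancel j)

  root : Fin n → Fin n
  root j = proj₁ (fixed j)

  root-square : ∀ j → root j ∙ root j ≡ j
  root-square j = trans (cong (root j ∙_) (trans (sym (proj₂ (fixed j))) (comm j (root j)))) (cancel (root j) j)

  root-injective : Injective _≡_ _≡_ root
  root-injective {a} {b} eq = trans (sym (root-square a)) (trans (cong₂ _∙_ eq eq) (root-square b))

  -- `root` is a section of squaring and, being injective on a finite set, hits both i and j; on its
  -- image squaring undoes it.
  conclude : ∀ {i j} → ∃ (λ a → root a ≡ i) → ∃ (λ b → root b ≡ j) → i ∙ i ≡ j ∙ j → i ≡ j
  conclude (a , refl) (b , refl) eq = cong root (trans (sym (root-square a)) (trans eq (root-square b)))

-- Powers of two and perfect codes in the Boolean cube.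

∣2^⇒≡2^ : ∀ m {d} → d ∣ 2 ^ m → ∃ λ t → d ≡ 2 ^ t
∣2^⇒≡2^ zero    d∣1 = 0 , ∣1⇒≡1 d∣1
∣2^⇒≡2^ (suc m) {d} (divides q 2^≡qd)
  with euclidsLemma q d prime[2] (divides (2 ^ m) (trans (sym 2^≡qd) (ℕ.*-comm 2 (2 ^ m))))
-- An even cofactor gives up its factor 2, so that d already divides 2 ^ m; an even d is halved
-- instead.
... | inj₁ (divides q′ refl) = ∣2^⇒≡2^ m (divides q′ (ℕ.*-cancelˡ-≡ _ _ 2 (begin
    2 * 2 ^ m     ≡⟨ 2^≡qd ⟩
    q′ * 2 * d    ≡⟨ cong (_* d) (ℕ.*-comm q′ 2) ⟩
    2 * q′ * d    ≡⟨ ℕ.*-assoc 2 q′ d ⟩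
    2 * (q′ * d)  ∎)))
... | inj₂ (divides d′ refl) with t , refl ← ∣2^⇒≡2^ m {d′} (divides q (ℕ.*-cancelʳ-≡ _ _ 2 (begin
    2 ^ m * 2     ≡⟨ ℕ.*-comm (2 ^ m) 2 ⟩
    2 * 2 ^ m     ≡⟨ 2^≡qd ⟩
    q * (d′ * 2)  ≡⟨ ℕ.*-assoc q d′ 2 ⟨
    q * d′ * 2    ∎)))
  = suc t , ℕ.*-comm (2 ^ t) 2

cubeSum : ∀ n → (Vec Bool n → ℕ) → ℕ
cubeSum zero    f = f []
cubeSum (suc n) f = cubeSum n (f ∘ (false ∷_)) + cubeSum n (f ∘ (true ∷_))

cubeSum-cong : ∀ n {f g} → (∀ v → f v ≡ g v) → cubeSum n f ≡ cubeSum n g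
cubeSum-cong zero    f≗g = f≗g []
cubeSum-cong (suc n) f≗g = cong₂ _+_ (cubeSum-cong n (f≗g ∘ _)) (cubeSum-cong n (f≗g ∘ _))

cubeSum-0 : ∀ n → cubeSum n (λ _ → 0) ≡ 0
cubeSum-0 zero    = refl
cubeSum-0 (suc n) = cong₂ _+_ (cubeSum-0 n) (cubeSum-0 n)

cubeSum-1 : ∀ n → cubeSum n (λ _ → 1) ≡ 2 ^ n
cubeSum-1 zero    = refl
cubeSum-1 (suc n) = cong₂ _+_ (cubeSum-1 n) (trans (cubeSum-1 n) (sym (ℕ.+-identityʳ _)))

cubeSum-+ : ∀ n f g → cubeSum n (λ v → f v + g v) ≡ cubeSum n f + cubeSum n g
cubeSum-+ zero    f g = refl
cubeSum-+ (suc n) f g = trans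
  (cong₂ _+_ (cubeSum-+ n (f ∘ (false ∷_)) (g ∘ (false ∷_))) (cubeSum-+ n (f ∘ (true ∷_)) (g ∘ (true ∷_))))
  (interchange ℕ.+-commutativeSemigroup (cubeSum n (f ∘ (false ∷_))) (cubeSum n (g ∘ (false ∷_)))
    (cubeSum n (f ∘ (true ∷_))) (cubeSum n (g ∘ (true ∷_))))

cubeSum-sum : ∀ n {m c} (f : Fin m → Vec Bool n → ℕ) → (∀ i → cubeSum n (f i) ≡ c) →
  cubeSum n (λ v → sum (λ i → f i v)) ≡ m * c
cubeSum-sum n {zero}  f eq = cubeSum-0 n
cubeSum-sum n {suc m} f eq =
  trans (cubeSum-+ n _ _) (cong₂ _+_ (eq zero) (cubeSum-sum n (f ∘ suc) (eq ∘ suc)))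

flip : ∀ {n} → Fin n → Vec Bool n → Vec Bool n
flip i v = updateAt v i not

cubeSum-flip : ∀ n (i : Fin n) f → cubeSum n (f ∘ flip i) ≡ cubeSum n f
cubeSum-flip (suc n) zero    f = ℕ.+-comm (cubeSum n (f ∘ (true ∷_))) _
cubeSum-flip (suc n) (suc i) f = cong₂ _+_ (cubeSum-flip n i _) (cubeSum-flip n i _)

-- Double counting: each flip permutes the vertices, so all n + 1 terms have the same total over the
-- cube.
perfect-code⇒suc∣2^ : ∀ n (f : Vec Bool n → ℕ) →
  (∀ v → f v + sum (λ i → f (flip i v)) ≡ 1) → suc n ∣ 2 ^ n
perfect-code⇒suc∣2^ n f perfect = divides (cubeSum n f) (begin
  2 ^ n                                                ≡⟨ cubeSum-1 n ⟨
  cubeSum n (λ _ → 1)                                  ≡⟨ cubeSum-cong n perfect ⟨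
  cubeSum n (λ v → f v + sum (λ i → f (flip i v)))      ≡⟨ cubeSum-+ n _ _ ⟩
  cubeSum n f + cubeSum n (λ v → sum (λ i → f (flip i v))) ≡⟨ cong (cubeSum n f +_) (cubeSum-sum n _ λ i → cubeSum-flip n i f) ⟩
  suc n * cubeSum n f                                  ≡⟨ ℕ.*-comm (suc n) _ ⟩
  cubeSum n f * suc n                                  ∎)

-- Axis directions and cubical codes.

Direction : ℕ → Set
Direction n = Fin n × Sign

opp : ∀ {n} → Direction n → Direction n
opp (i , s) = i , opposite s

opp-involutive : ∀ {n} (d : Direction n) → opp (opp d) ≡ d
opp-involutive (i , s) = cong (i ,_) (opposite-involutive s)

d≢opp[d] : ∀ {n} (d : Direction n) → d ≢ opp d
d≢opp[d] (i , s) eq = s≢opposite[s] s (cong proj₂ eq)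

≡⊎≡opp : ∀ {n} {i : Fin n} s s′ → (i , s) ≡ (i , s′) ⊎ (i , s) ≡ opp (i , s′)
≡⊎≡opp Sign.+ Sign.+ = inj₁ refl
≡⊎≡opp Sign.+ Sign.- = inj₂ refl
≡⊎≡opp Sign.- Sign.+ = inj₂ refl
≡⊎≡opp Sign.- Sign.- = inj₁ refl

-- For X = ℤⁿ these are the perfect dominating sets whose components are cubes {a, a + 1}ⁿ.
record IsCubicalCode {n} {X : Set} (_⊕_ : X → Direction n → X) (S : X → Set) : Set where
  field
    ⊕-comm    : ∀ z d e → (z ⊕ d) ⊕ e ≡ (z ⊕ e) ⊕ d
    ⊕-opp     : ∀ z d → (z ⊕ d) ⊕ opp d ≡ z
    S?        : ∀ z → Dec (S z)
    dominated : ∀ {z} → ¬ S z → ∃ λ d → S (z ⊕ d)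
    unique    : ∀ {z d e} → ¬ S z → S (z ⊕ d) → S (z ⊕ e) → d ≡ e
    paired    : ∀ {z} d → S z → S (z ⊕ d) ⊎ S (z ⊕ opp d)
    unpaired  : ∀ {z d} → S z → S (z ⊕ d) → ¬ S (z ⊕ opp d)

-- Local geometry of a cubical code.

module CubicalCode {n} {X : Set} {_⊕_ : X → Direction n → X} {S : X → Set}
  (isCubicalCode : IsCubicalCode _⊕_ S) where

  open IsCubicalCode isCubicalCode

  infixl 6 _⊞_
  _⊞_ : X → Direction n → X
  _⊞_ = _⊕_

  opp-⊕ : ∀ z d → z ⊞ opp d ⊞ d ≡ z
  opp-⊕ z d = trans (cong (z ⊞ opp d ⊞_) (sym (opp-involutive d))) (⊕-opp z (opp d))

  ⊕-comm₂ : ∀ z a b c → z ⊞ a ⊞ b ⊞ c ≡ z ⊞ c ⊞ a ⊞ b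
  ⊕-comm₂ z a b c = trans (⊕-comm _ b c) (cong (_⊞ b) (⊕-comm z a c))

  ⊕-comm₃ : ∀ z a b c d → z ⊞ a ⊞ b ⊞ c ⊞ d ≡ z ⊞ d ⊞ a ⊞ b ⊞ c
  ⊕-comm₃ z a b c d = trans (⊕-comm _ c d) (cong (_⊞ c) (⊕-comm₂ z a b d))

  ⊕-opp₁ : ∀ z d e → z ⊞ d ⊞ e ⊞ opp d ≡ z ⊞ e
  ⊕-opp₁ z d e = trans (⊕-comm _ e (opp d)) (cong (_⊞ e) (⊕-opp z d))

  -- If z + d were outside S, its S-neighbours z and z + d + e would lie in the directions -d and e,
  -- which uniqueness identifies.
  middle : ∀ {z d e} → S z → S (z ⊞ d ⊞ e) → e ≢ opp d → S (z ⊞ d)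
  middle {z} {d} Sz S′ e≢opp with S? (z ⊞ d)
  ... | yes p = p
  ... | no ¬p = contradiction (unique ¬p S′ (subst S (sym (⊕-opp z d)) Sz)) e≢opp

  no-two-step : ∀ {z d} → S z → ¬ S (z ⊞ d ⊞ d)
  no-two-step {z} {d} Sz S′ =
    unpaired (middle Sz S′ (d≢opp[d] d)) S′ (subst S (sym (⊕-opp z d)) Sz)

  -- For z ∈ S exactly one neighbour along axis i is in S, so testing one sign finds the outward
  -- vector oᵢ. Off S the value has no meaning.
  out : X → Fin n → Direction n
  out z i = i , (if does (S? (z ⊞ (i , Sign.+))) then Sign.- else Sign.+)

  out-∉ : ∀ {z} → S z → ∀ i → ¬ S (z ⊞ out z i)
  out-∉ {z} Sz i with S? (z ⊞ (i , Sign.+))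
  ... | yes p = unpaired Sz p
  ... | no ¬p = ¬p

  out-unique : ∀ {z} d → S z → ¬ S (z ⊞ d) → out z (proj₁ d) ≡ d
  out-unique {z} d@(i , s) Sz ¬S′ with ≡⊎≡opp {i = i} (proj₂ (out z i)) s
  ... | inj₁ eq = eq
  ... | inj₂ eq with paired d Sz
  ...   | inj₁ S′ = contradiction S′ ¬S′
  ...   | inj₂ S′ = contradiction (subst (S ∘ (z ⊞_)) (sym eq) S′) (out-∉ Sz i)

  out-unique′ : ∀ {z} d → S z → S (z ⊞ opp d) → out z (proj₁ d) ≡ d
  out-unique′ d Sz S′ = out-unique d Sz (λ S″ → unpaired Sz S″ S′)

  out≢opp[out] : ∀ z i j → out z j ≢ opp (out z i)
  out≢opp[out] z i j eq with refl ← cong proj₁ eq = d≢opp[d] (out z i) eq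

  -- For z ∈ S this crosses the cube of z along axis k; the turns act on S as commuting involutions.
  turn : Fin n → X → X
  turn k z = z ⊞ opp (out z k)

  S-turn : ∀ {z} k → S z → S (turn k z)
  S-turn {z} k Sz with paired (out z k) Sz
  ... | inj₁ S′ = contradiction S′ (out-∉ Sz k)
  ... | inj₂ S′ = S′

  out-turn-≡ : ∀ {z} k → S z → out (turn k z) k ≡ opp (out z k)
  out-turn-≡ {z} k Sz = out-unique′ (opp (out z k)) (S-turn k Sz)
    (subst S (sym (⊕-opp z (opp (out z k)))) Sz)

  -- The point z - oₖ - oⱼ is the midpoint of a path from `turn k z` to `turn j z`, hence in S by
  -- `middle`; so oⱼ still leads out after the turn.
  out-turn-≢ : ∀ {z j} k → S z → j ≢ k → out (turn k z) j ≡ out z j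
  out-turn-≢ {z} {j} k Sz j≢k = out-unique′ (out z j) (S-turn k Sz)
    (middle (S-turn k Sz)
      (subst S (sym (trans (⊕-comm _ _ _) (cong (_⊞ opp (out z j)) (opp-⊕ z (out z k))))) (S-turn j Sz))
      (λ eq → j≢k (sym (cong proj₁ eq))))

  turn-involutive : ∀ {z} k → S z → turn k (turn k z) ≡ z
  turn-involutive {z} k Sz =
    trans (cong (λ d → turn k z ⊞ opp d) (out-turn-≡ k Sz)) (⊕-opp z (opp (out z k)))

  turn-comm : ∀ {z} j k → S z → turn j (turn k z) ≡ turn k (turn j z)
  turn-comm {z} j k Sz with j ≟ k
  ... | yes refl = refl
  ... | no j≢k = begin
    turn k z ⊞ opp (out (turn k z) j)  ≡⟨ cong (λ d → turn k z ⊞ opp d) (out-turn-≢ k Sz j≢k) ⟩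
    turn k z ⊞ opp (out z j)           ≡⟨ ⊕-comm z _ _ ⟩
    turn j z ⊞ opp (out z k)           ≡⟨ cong (λ d → turn j z ⊞ opp d) (out-turn-≢ j Sz (j≢k ∘ sym)) ⟨
    turn k (turn j z)                  ∎

  -- At each z ∈ S this is the graph of a totally symmetric quasigroup on the coordinates.
  Line : X → Fin n → Fin n → Fin n → Set
  Line z i j k = S (z ⊞ out z i ⊞ out z j ⊞ out z k)

  -- Otherwise `middle` would put z + oᵢ in S. The case i = j is included.
  corner-∉ : ∀ {z} i j → S z → ¬ S (z ⊞ out z i ⊞ out z j)
  corner-∉ {z} i j Sz S′ = out-∉ Sz i (middle Sz S′ (out≢opp[out] z i j))

  -- The dominating direction cannot be -oₖ: for k = i or k = j it would lead to z + oⱼ or z + oᵢ,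
  -- and otherwise to a corner of `turn k z`.
  third : ∀ {z} → S z → ∀ i j → ∃ (Line z i j)
  third {z} Sz i j with (k , s) , S′ ← dominated (corner-∉ i j Sz) with ≡⊎≡opp {i = k} s (proj₂ (out z k))
  ... | inj₁ refl = k , S′
  ... | inj₂ refl = contradiction S′ inner-∉
    where
    inner-∉ : ¬ S (z ⊞ out z i ⊞ out z j ⊞ opp (out z k))
    inner-∉ S″ with i ≟ k | j ≟ k
    ... | yes refl | _ = out-∉ Sz j (subst S (⊕-opp₁ z (out z i) (out z j)) S″)
    ... | no _ | yes refl = out-∉ Sz i (subst S (⊕-opp _ (out z j)) S″)
    ... | no i≢k | no j≢k = corner-∉ i j (S-turn k Sz) (subst S (begin
      z ⊞ out z i ⊞ out z j ⊞ opp (out z k)              ≡⟨ ⊕-comm₂ z _ _ _ ⟩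
      turn k z ⊞ out z i ⊞ out z j                       ≡⟨ cong₂ (λ d e → turn k z ⊞ d ⊞ e) (out-turn-≢ k Sz i≢k) (out-turn-≢ k Sz j≢k) ⟨
      turn k z ⊞ out (turn k z) i ⊞ out (turn k z) j     ∎) S″)

  third-unique : ∀ {z i j k k′} → S z → Line z i j k → Line z i j k′ → k ≡ k′
  third-unique Sz l l′ = cong proj₁ (unique (corner-∉ _ _ Sz) l l′)

  Line-swap₁₂ : ∀ {z i j k} → Line z i j k → Line z j i k
  Line-swap₁₂ {z} {i} {j} {k} = subst S (cong (_⊞ out z k) (⊕-comm z (out z i) (out z j)))

  Line-swap₂₃ : ∀ {z i j k} → Line z i j k → Line z i k j
  Line-swap₂₃ {z} {i} {j} {k} = subst S (⊕-comm _ (out z j) (out z k))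

  straight-turn : ∀ {z i} k → S z → i ≢ k → Line z i i i → Line (turn k z) i i i
  straight-turn {z} {i} k Sz i≢k straight with j , line ← third (S-turn k Sz) i i with j ≟ i
  ... | yes refl = line
  ... | no _ with paired (out (turn k z) i) line
  ...   | inj₂ S′ = contradiction (subst S (⊕-opp₁ _ o p) S′) (corner-∉ i j S₁)
    where
    S₁ = S-turn k Sz
    o = out (turn k z) i
    p = out (turn k z) j
  ...   | inj₁ S′ = subst S (⊕-comm₃ z o o o a) (middle S₃ (subst S (begin
    z ⊞ a ⊞ o ⊞ o ⊞ p ⊞ o   ≡⟨ ⊕-comm _ p o ⟩
    z ⊞ a ⊞ o ⊞ o ⊞ o ⊞ p   ≡⟨ cong (_⊞ p) (⊕-comm₃ z o o o a) ⟨
    z ⊞ o ⊞ o ⊞ o ⊞ a ⊞ p   ∎) S′) p≢opp)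
    where
    o = out (turn k z) i
    p = out (turn k z) j
    a = opp (out z k)

    S₃ : S (z ⊞ o ⊞ o ⊞ o)
    S₃ = subst (λ d → S (z ⊞ d ⊞ d ⊞ d)) (sym (out-turn-≢ k Sz i≢k)) straight

    -- At `turn k z` the direction p leaves S, whereas -a returns to z.
    p≢opp : p ≢ opp a
    p≢opp eq = out-∉ (S-turn k Sz) j
      (subst S (sym (trans (cong (turn k z ⊞_) eq) (⊕-opp z a))) Sz)

  -- Pair z + 2oᵢ + oⱼ ∈ S along axis k. The neighbour at +oₖ would be a double step along axis j
  -- from the point of S given by the second line; the one at -oₖ is the required point.
  line-back : ∀ {z i j k} → S z → i ≢ j → i ≢ k → j ≢ k →
    Line z i i j → Line (turn j z) i i k → Line (turn k z) i i j
  line-back {z} {i} {j} {k} Sz i≢j i≢k j≢k line line′ with paired (out z k) line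
  ... | inj₁ S′ = contradiction (subst S (begin
    turn j z ⊞ out (turn j z) i ⊞ out (turn j z) i ⊞ out (turn j z) k
      ≡⟨ cong₂ (λ d e → turn j z ⊞ d ⊞ d ⊞ e) (out-turn-≢ j Sz i≢j) (out-turn-≢ j Sz (j≢k ∘ sym)) ⟩
    z ⊞ opp p ⊞ o ⊞ o ⊞ q              ≡⟨ ⊕-comm₃ z o o q (opp p) ⟨
    z ⊞ o ⊞ o ⊞ q ⊞ opp p              ≡⟨ cong (_⊞ opp p) (⊕-opp₁ _ p q) ⟨
    z ⊞ o ⊞ o ⊞ p ⊞ q ⊞ opp p ⊞ opp p  ∎) line′) (no-two-step S′)
    where
    o = out z i
    p = out z j
    q = out z k
  ... | inj₂ S′ = subst S (begin
    z ⊞ out z i ⊞ out z i ⊞ out z j ⊞ opp (out z k)  ≡⟨ ⊕-comm₃ z _ _ _ _ ⟩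
    turn k z ⊞ out z i ⊞ out z i ⊞ out z j
      ≡⟨ cong₂ (λ d e → turn k z ⊞ d ⊞ d ⊞ e) (out-turn-≢ k Sz i≢k) (out-turn-≢ k Sz j≢k) ⟨
    turn k z ⊞ out (turn k z) i ⊞ out (turn k z) i ⊞ out (turn k z) j  ∎) S′

  -- Squares and periodicity in odd dimension.

  module OddDimension (m : ℕ) (odd : n ≡ suc (2 * m)) where

    -- The quasigroup at z is given by `third`; commutativity and cancellation come from permuting
    -- the arguments of `Line`.
    diagonal-injective : ∀ {z i j k} → S z → Line z i i k → Line z j j k → i ≡ j
    diagonal-injective {z} {i} {j} Sz line line′ =
      square-injective m odd (λ a b → proj₁ (third Sz a b))
        (λ a b → third-unique Sz (proj₂ (third Sz a b)) (Line-swap₁₂ (proj₂ (third Sz b a))))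
        (λ a b → third-unique Sz (proj₂ (third Sz a _)) (Line-swap₂₃ (proj₂ (third Sz a b))))
        (trans (third-unique Sz (proj₂ (third Sz i i)) line)
          (third-unique Sz line′ (proj₂ (third Sz j j))))

    -- Otherwise, seen from y = z + 2oᵢ + oⱼ ∈ S, both squares i² and j² equal j.
    line-moves : ∀ {z i j} → S z → i ≢ j → Line z i i j → ¬ Line (turn j z) i i j
    line-moves {z} {i} {j} Sz i≢j line line′ = i≢j (diagonal-injective Sy
      (subst S (sym (begin
        y ⊞ out y i ⊞ out y i ⊞ out y j  ≡⟨ cong₂ (λ d e → y ⊞ d ⊞ d ⊞ e) out-y-i out-y-j ⟩
        y ⊞ opp o ⊞ opp o ⊞ opp p        ≡⟨ cong (λ x → x ⊞ opp o ⊞ opp p) (⊕-opp₁ _ o p) ⟩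
        z ⊞ o ⊞ p ⊞ opp o ⊞ opp p        ≡⟨ cong (_⊞ opp p) (⊕-opp₁ z o p) ⟩
        z ⊞ p ⊞ opp p                    ≡⟨ ⊕-opp z p ⟩
        z                                ∎)) Sz)
      (subst S (begin
        turn j z ⊞ out (turn j z) i ⊞ out (turn j z) i ⊞ out (turn j z) j
          ≡⟨ cong₂ (λ d e → turn j z ⊞ d ⊞ d ⊞ e) (out-turn-≢ j Sz i≢j) (out-turn-≡ j Sz) ⟩
        z ⊞ opp p ⊞ o ⊞ o ⊞ opp p        ≡⟨ cong (_⊞ opp p) (⊕-comm₂ z o o (opp p)) ⟨
        z ⊞ o ⊞ o ⊞ opp p ⊞ opp p        ≡⟨ cong (λ x → x ⊞ opp p ⊞ opp p) (⊕-opp _ p) ⟨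
        y ⊞ opp p ⊞ opp p ⊞ opp p        ≡⟨ cong (λ d → y ⊞ d ⊞ d ⊞ d) out-y-j ⟨
        y ⊞ out y j ⊞ out y j ⊞ out y j  ∎) line′))
      where
      o = out z i
      p = out z j
      y = z ⊞ o ⊞ o ⊞ p

      Sy : S y
      Sy = line

      -- The points y - oᵢ = z + oᵢ + oⱼ and y - oⱼ = z + 2oᵢ are corners of z, so both outward
      -- directions are reversed at y.
      out-y-i : out y i ≡ opp o
      out-y-i = out-unique (opp o) Sy (corner-∉ i j Sz ∘ subst S (⊕-opp₁ _ o p))

      out-y-j : out y j ≡ opp p
      out-y-j = out-unique (opp p) Sy (corner-∉ i i Sz ∘ subst S (⊕-opp _ p))

    straight : ∀ {z} → S z → ∀ i → Line z i i i
    straight {z} Sz i with S? (z ⊞ out z i ⊞ out z i ⊞ out z i)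
    ... | yes line = line
    ... | no bent = contradiction (Sz , bent)
      (no-colouring Bent turn square Bent-turn
        (λ j → turn-involutive j ∘ proj₁) (λ j k → turn-comm j k ∘ proj₁) moves back)
      where
      Bent : X → Set
      Bent z = S z × ¬ Line z i i i

      square : X → Fin n
      square z with S? z
      ... | yes Sz = proj₁ (third Sz i i)
      -- A placeholder: the colouring argument uses colours of points of S only.
      ... | no _   = i

      square-line : ∀ {z} → S z → Line z i i (square z)
      square-line {z} Sz with S? z
      ... | yes Sz′ = proj₂ (third Sz′ i i)
      ... | no ¬Sz  = contradiction Sz ¬Sz

      i≢square : ∀ {z} → Bent z → i ≢ square z
      i≢square {z} (Sz , bent) eq = bent (subst (Line z i i) (sym eq) (square-line Sz))

      Bent-turn : ∀ {a b} → Bent a → Bent b → Bent (turn (square a) b)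
      -- Turning back along k would carry straightness from the turned point to b.
      Bent-turn {a} {b} Ba (Sb , bent) = S-turn k Sb , λ line →
        bent (subst (λ z → Line z i i i) (turn-involutive k Sb)
          (straight-turn k (S-turn k Sb) (i≢square Ba) line))
        where k = square a

      moves : ∀ {a} → Bent a → square (turn (square a) a) ≢ square a
      moves {a} Ba@(Sa , _) eq = line-moves Sa (i≢square Ba) (square-line Sa)
        (subst (Line _ i i) eq (square-line (S-turn (square a) Sa)))

      back : ∀ {a} → Bent a → square (turn (square (turn (square a) a)) a) ≡ square a
      back {a} Ba@(Sa , _) = third-unique (S-turn _ Sa) (square-line (S-turn _ Sa))
        (line-back Sa (i≢square Ba) (i≢square (Bent-turn Ba Ba)) (moves Ba ∘ sym)
          (square-line Sa) (square-line (S-turn _ Sa)))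

    -- Period four and perfect codes of double steps.

    periodic : ∀ {z} d → S z → S (z ⊞ d ⊞ d ⊞ d ⊞ d)
    periodic {z} d@(i , s) Sz with ≡⊎≡opp {i = i} s (proj₂ (out z i))
    -- An inward d crosses the cube and then points outward, so three more steps reach S. An outward
    -- d reaches S after three steps, and pairing gives a fourth because z + 2d is a corner.
    ... | inj₂ refl = subst (λ e → S (turn i z ⊞ e ⊞ e ⊞ e)) (out-turn-≡ i Sz) (straight (S-turn i Sz) i)
    ... | inj₁ refl with paired d (straight Sz i)
    ...   | inj₁ S′ = S′
    ...   | inj₂ S′ = contradiction (subst S (⊕-opp _ d) S′) (corner-∉ i i Sz)

    two-step : ∀ {z} d → ¬ S z → S (z ⊞ d) → S (z ⊞ d ⊞ d)
    two-step {z} d ¬Sz S′ with paired d S′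
    ... | inj₁ S″ = S″
    ... | inj₂ S″ = contradiction (subst S (⊕-opp z d) S″) ¬Sz

    periodic-opp : ∀ {z} d → S (z ⊞ d ⊞ d ⊞ d) → S (z ⊞ opp d)
    periodic-opp {z} d S′ = subst S (begin
      z ⊞ d ⊞ d ⊞ d ⊞ opp d ⊞ opp d ⊞ opp d ⊞ opp d  ≡⟨ cong (λ x → x ⊞ opp d ⊞ opp d ⊞ opp d) (⊕-opp _ d) ⟩
      z ⊞ d ⊞ d ⊞ opp d ⊞ opp d ⊞ opp d              ≡⟨ cong (λ x → x ⊞ opp d ⊞ opp d) (⊕-opp _ d) ⟩
      z ⊞ d ⊞ opp d ⊞ opp d                          ≡⟨ cong (_⊞ opp d) (⊕-opp z d) ⟩
      z ⊞ opp d                                      ∎) (periodic (opp d) S′)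

    -- The two endpoints differ by 4d, so the sign of a double step is immaterial.
    opp-two-step : ∀ {z} d → S (z ⊞ d ⊞ d) → S (z ⊞ opp d ⊞ opp d)
    opp-two-step {z} d S′ = periodic-opp d (subst S (begin
      z ⊞ d ⊞ d                    ≡⟨ cong (_⊞ d) (opp-⊕ (z ⊞ d) d) ⟨
      z ⊞ d ⊞ opp d ⊞ d ⊞ d        ≡⟨ cong (λ x → x ⊞ d ⊞ d) (⊕-comm z d (opp d)) ⟩
      z ⊞ opp d ⊞ d ⊞ d ⊞ d        ∎) S′)

    -- The S-partner of z + 2d along d is z + d or z + 3d, and the latter is z - d up to period
    -- four. Uniqueness of neighbours thus carries over to double steps.
    two-step-neighbour : ∀ {z} d → S (z ⊞ d ⊞ d) → S (z ⊞ d) ⊎ S (z ⊞ opp d)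
    two-step-neighbour {z} d S′ with paired d S′
    ... | inj₁ S″ = inj₂ (periodic-opp d S″)
    ... | inj₂ S″ = inj₁ (subst S (⊕-opp _ d) S″)

    two-step-exists : ∀ {z} (σ : Fin n → Sign) → ¬ S z → ∃ λ i → S (z ⊞ (i , σ i) ⊞ (i , σ i))
    two-step-exists σ ¬Sz with d@(i , s) , S′ ← dominated ¬Sz with ≡⊎≡opp {i = i} (σ i) s
    ... | inj₁ refl = i , two-step d ¬Sz S′
    ... | inj₂ eq   = i , subst (λ e → S (_ ⊞ e ⊞ e)) (sym eq) (opp-two-step d (two-step d ¬Sz S′))

    two-step-unique : ∀ {z} d e → ¬ S z → S (z ⊞ d ⊞ d) → S (z ⊞ e ⊞ e) → proj₁ d ≡ proj₁ e
    two-step-unique d e ¬Sz S′ S″ with two-step-neighbour d S′ | two-step-neighbour e S″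
    ... | inj₁ p | inj₁ q = cong proj₁ (unique ¬Sz p q)
    ... | inj₁ p | inj₂ q = cong proj₁ (unique ¬Sz p q)
    ... | inj₂ p | inj₁ q = cong proj₁ (unique ¬Sz p q)
    ... | inj₂ p | inj₂ q = cong proj₁ (unique ¬Sz p q)

    indicator-S : X → ℕ
    indicator-S z = indicator (S? z)

    two-step-sum : ∀ z (σ : Fin n → Sign) →
      indicator-S z + sum (λ i → indicator-S (z ⊞ (i , σ i) ⊞ (i , σ i))) ≡ 1
    two-step-sum z σ with S? z
    ... | yes Sz = cong suc (trans (sum-cong-≗ {n} (λ i → indicator-no (S? _) (no-two-step {d = i , σ i} Sz))) (sum-replicate-zero n))
    ... | no ¬Sz with i , S′ ← two-step-exists σ ¬Sz =
      sum-single i (indicator-yes (S? _) S′) (λ j j≢i → indicator-no (S? _) (λ S″ → j≢i (two-step-unique _ _ ¬Sz S″ S′)))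

    -- By `two-step-sum`, S pulls back along e to a perfect code. The sign depends on v since a bit
    -- may be flipped either way.
    suc[n]∣2^n : (e : Vec Bool n → X) (σ : Vec Bool n → Fin n → Sign) →
      (∀ v i → e (flip i v) ≡ e v ⊞ (i , σ v i) ⊞ (i , σ v i)) → suc n ∣ 2 ^ n
    suc[n]∣2^n e σ e-flip = perfect-code⇒suc∣2^ n (indicator-S ∘ e) (λ v →
      trans (cong (indicator-S (e v) +_) (sum-cong-≗ (λ i → cong indicator-S (e-flip v i))))
        (two-step-sum (e v) (σ v)))

-- Cells and unit steps in integer coordinates.

unit : Sign → ℤ
unit s = s ℤ.◃ 1

InCell : ℤ → Set
InCell a = a ≡ 0ℤ ⊎ a ≡ -1ℤ

InCell-pair : ∀ s {a} → InCell a → InCell (a ℤ.+ unit s) ⊎ InCell (a ℤ.+ unit (opposite s))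
InCell-pair Sign.+ (inj₁ refl) = inj₂ (inj₂ refl)
InCell-pair Sign.+ (inj₂ refl) = inj₁ (inj₁ refl)
InCell-pair Sign.- (inj₁ refl) = inj₁ (inj₂ refl)
InCell-pair Sign.- (inj₂ refl) = inj₂ (inj₁ refl)

-- The two points are two apart and the cell has length one. Expressing both through b = a +
-- `unit s` leaves a finite check.
InCell-no-gap : ∀ s {a} → InCell (a ℤ.+ unit s) → ¬ InCell (a ℤ.+ unit (opposite s))
InCell-no-gap s {a} p q = distance-two s p (subst InCell (shift s a) q)
  where
  distance-two : ∀ s {b} → InCell b → ¬ InCell (b ℤ.+ unit (opposite s) ℤ.+ unit (opposite s))
  distance-two Sign.+ (inj₁ refl) (inj₁ ())
  distance-two Sign.+ (inj₁ refl) (inj₂ ())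
  distance-two Sign.+ (inj₂ refl) (inj₁ ())
  distance-two Sign.+ (inj₂ refl) (inj₂ ())
  distance-two Sign.- (inj₁ refl) (inj₁ ())
  distance-two Sign.- (inj₁ refl) (inj₂ ())
  distance-two Sign.- (inj₂ refl) (inj₁ ())
  distance-two Sign.- (inj₂ refl) (inj₂ ())

  shift : ∀ s a → a ℤ.+ unit (opposite s) ≡ a ℤ.+ unit s ℤ.+ unit (opposite s) ℤ.+ unit (opposite s)
  shift Sign.+ = solve-∀
  shift Sign.- = solve-∀

∣i∣≡1⇒unit : ∀ {i} → ∣ i ∣ ≡ 1 → ∃ λ s → i ≡ unit s
∣i∣≡1⇒unit {ℤ.+ 1}        refl = Sign.+ , refl
∣i∣≡1⇒unit { ℤ.-[1+ 0 ]} refl = Sign.- , refl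

sum≤0 : ∀ {n} (f : Fin n → ℕ) → sum f ≤ 0 → ∀ i → f i ≡ 0
sum≤0 f le zero    = ℕ.n≤0⇒n≡0 (ℕ.m+n≤o⇒m≤o _ le)
sum≤0 f le (suc i) = sum≤0 (f ∘ suc) (ℕ.m+n≤o⇒n≤o (f zero) le) i

sum≤1 : ∀ {n} (f : Fin n → ℕ) → sum f ≤ 1 →
  (∀ i → f i ≡ 0) ⊎ ∃ λ i → f i ≡ 1 × (∀ j → j ≢ i → f j ≡ 0)
sum≤1 {zero}  f le = inj₁ λ ()
sum≤1 {suc n} f le with f zero in eq
... | suc (suc _) = contradiction le λ { (s≤s ()) }
... | suc zero = inj₂ (zero , eq , λ
  { zero    0≢0 → contradiction refl 0≢0
  ; (suc j) _   → sum≤0 (f ∘ suc) (ℕ.s≤s⁻¹ le) j })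
... | zero with sum≤1 (f ∘ suc) le
...   | inj₁ all0 = inj₁ λ { zero → eq ; (suc i) → all0 i }
...   | inj₂ (i , fi≡1 , other) = inj₂ (suc i , fi≡1 , λ
  { zero    _   → eq
  ; (suc j) j≢i → other j (j≢i ∘ cong suc) })

infixl 6 _⊕_
-- Points are vectors rather than functions so that the laws of steps are propositional equalities
-- without function extensionality.
_⊕_ : ∀ {n} → Vec ℤ n → Direction n → Vec ℤ n
v ⊕ (i , s) = updateAt v i (ℤ._+ unit s)

⊕-comm : ∀ {n} (v : Vec ℤ n) d e → v ⊕ d ⊕ e ≡ v ⊕ e ⊕ d
⊕-comm v (i , s) (j , s′) with i ≟ j
... | no i≢j = updateAt-commutes j i (i≢j ∘ sym) v
... | yes refl = begin
  v ⊕ (i , s) ⊕ (i , s′)                      ≡⟨ updateAt-updateAt i v ⟩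
  updateAt v i (λ a → a ℤ.+ unit s ℤ.+ unit s′)  ≡⟨ updateAt-cong i (λ a → swap a (unit s) (unit s′)) v ⟩
  updateAt v i (λ a → a ℤ.+ unit s′ ℤ.+ unit s)  ≡⟨ updateAt-updateAt i v ⟨
  v ⊕ (i , s′) ⊕ (i , s)                      ∎
  where
  swap : ∀ a b c → a ℤ.+ b ℤ.+ c ≡ a ℤ.+ c ℤ.+ b
  swap = solve-∀

⊕-opp : ∀ {n} (v : Vec ℤ n) d → v ⊕ d ⊕ opp d ≡ v
⊕-opp v (i , s) =
  trans (updateAt-updateAt i v) (updateAt-id-local i v (cancel s (lookup v i)))
  where
  cancel : ∀ s a → a ℤ.+ unit s ℤ.+ unit (opposite s) ≡ a
  cancel Sign.+ = solve-∀
  cancel Sign.- = solve-∀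

lookup-⊖-⊕-≡ : ∀ {n} (v : Vec ℤ n) x i s →
  (lookup (v ⊕ (i , s)) ⊖ x) i ≡ (lookup v ⊖ x) i ℤ.+ unit s
lookup-⊖-⊕-≡ v x i s = trans (cong (_- x i) (lookup∘updateAt i v)) (swap (lookup v i) (unit s) (x i))
  where
  swap : ∀ a b c → a ℤ.+ b - c ≡ a - c ℤ.+ b
  swap = solve-∀

lookup-⊖-⊕-≢ : ∀ {n} (v : Vec ℤ n) x i s {j} → j ≢ i →
  (lookup (v ⊕ (i , s)) ⊖ x) j ≡ (lookup v ⊖ x) j
lookup-⊖-⊕-≢ v x i s {j} j≢i = cong (_- x j) (lookup∘updateAt′ j i j≢i v)

Cell⇒Υ : ∀ {n} {u : ℤ^ n} → IsZeroMinusOneVec u → Υ n u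
Cell⇒Υ {n} {u} cell = u , cell , ℕ.≤-trans (ℕ.≤-reflexive
  (trans (sum-cong-≗ {n} (λ i → cong ∣_∣ (ℤ.i≡j⇒i-j≡0 {u i} refl))) (sum-replicate-zero n))) z≤n

Cell-⊕⇒Υ : ∀ {n} (v : Vec ℤ n) x d → IsZeroMinusOneVec (lookup (v ⊕ d) ⊖ x) → Υ n (lookup v ⊖ x)
Cell-⊕⇒Υ v x d@(i , s) cell = _ , cell , ℕ.≤-reflexive (sum-single i at-i elsewhere)
  where
  u  = lookup v ⊖ x
  u′ = lookup (v ⊕ d) ⊖ x

  cancel : ∀ a b → a ℤ.+ b - a ≡ b
  cancel = solve-∀

  at-i : ∣ u′ i - u i ∣ ≡ 1
  at-i = begin
    ∣ u′ i - u i ∣              ≡⟨ cong (λ a → ∣ a - u i ∣) (lookup-⊖-⊕-≡ v x i s) ⟩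
    ∣ u i ℤ.+ unit s - u i ∣    ≡⟨ cong ∣_∣ (cancel (u i) (unit s)) ⟩
    ∣ unit s ∣                  ≡⟨ ℤ.abs-◃ s 1 ⟩
    1                           ∎

  elsewhere : ∀ j → j ≢ i → ∣ u′ j - u j ∣ ≡ 0
  elsewhere j j≢i = cong ∣_∣ (ℤ.i≡j⇒i-j≡0 (lookup-⊖-⊕-≢ v x i s j≢i))

-- The cubes of a tiling form a cubical code.

module Tiling {n} {T : ℤ^ n → Set} (tiling : IsIntegerTiling n T) where

  cover    = proj₁ tiling
  disjoint = proj₂ tiling

  Core : Vec ℤ n → Set
  Core v = ∃ λ x → T x × IsZeroMinusOneVec (lookup v ⊖ x)

  -- If v + d lies in the cube of y, then v lies in the translate of y as well as in that of x, so
  -- disjointness gives y = x.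
  Core-⊕ : ∀ v {x} d → T x → Υ n (lookup v ⊖ x) → Core (v ⊕ d) → IsZeroMinusOneVec (lookup (v ⊕ d) ⊖ x)
  Core-⊕ v {x} d Tx υ (y , Ty , cell) =
    subst (λ x → IsZeroMinusOneVec (lookup (v ⊕ d) ⊖ x))
      (disjoint (lookup v) y x Ty Tx (Cell-⊕⇒Υ v y d cell) υ) cell

  opposite-∉ : ∀ (v : Vec ℤ n) x d → IsZeroMinusOneVec (lookup (v ⊕ d) ⊖ x) →
    ¬ IsZeroMinusOneVec (lookup (v ⊕ opp d) ⊖ x)
  opposite-∉ v x (i , s) p q = InCell-no-gap s {(lookup v ⊖ x) i}
    (subst InCell (lookup-⊖-⊕-≡ v x i s) (p i))
    (subst InCell (lookup-⊖-⊕-≡ v x i (opposite s)) (q i))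

  -- T itself need not be decidable: `cover` supplies a centre, and disjointness makes it the only
  -- candidate.
  Core? : ∀ v → Dec (Core v)
  Core? v with x , Tx , υ ← cover (lookup v)
      with all? (λ i → ((lookup v ⊖ x) i ℤ.≟ 0ℤ) ⊎-dec ((lookup v ⊖ x) i ℤ.≟ -1ℤ))
  ... | yes cell = yes (x , Tx , cell)
  ... | no ¬cell = no λ (y , Ty , cell) → ¬cell
    (subst (λ x → IsZeroMinusOneVec (lookup v ⊖ x)) (disjoint (lookup v) y x Ty Tx (Cell⇒Υ cell) υ) cell)

  dominated : ∀ {v} → ¬ Core v → ∃ λ d → Core (v ⊕ d)
  dominated {v} ¬core with x , Tx , y , cell , dist≤1 ← cover (lookup v) with sum≤1 _ dist≤1
  ... | inj₁ equal = contradiction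
    (x , Tx , λ i → subst InCell (ℤ.i-j≡0⇒i≡j _ _ (ℤ.∣i∣≡0⇒i≡0 (equal i))) (cell i)) ¬core
  ... | inj₂ (i , dist≡1 , equal) with s , y-u≡s ← ∣i∣≡1⇒unit dist≡1 = (i , s) , x , Tx , cell′
    where
    restore : ∀ a b → a ≡ b ℤ.+ (a - b)
    restore = solve-∀

    cell′ : IsZeroMinusOneVec (lookup (v ⊕ (i , s)) ⊖ x)
    cell′ j with j ≟ i
    ... | no j≢i = subst InCell (trans (ℤ.i-j≡0⇒i≡j _ _ (ℤ.∣i∣≡0⇒i≡0 (equal j j≢i)))
      (sym (lookup-⊖-⊕-≢ v x i s j≢i))) (cell j)
    ... | yes refl = subst InCell (begin
      y i                                              ≡⟨ restore (y i) ((lookup v ⊖ x) i) ⟩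
      (lookup v ⊖ x) i ℤ.+ (y i - (lookup v ⊖ x) i)    ≡⟨ cong (ℤ._+_ ((lookup v ⊖ x) i)) y-u≡s ⟩
      (lookup v ⊖ x) i ℤ.+ unit s                      ≡⟨ lookup-⊖-⊕-≡ v x i s ⟨
      (lookup (v ⊕ (i , s)) ⊖ x) i                     ∎) (cell i)

  -- By `Core-⊕` both neighbours lie in one cube. With opposite signs on one axis they would be two
  -- apart; on different axes each coordinate of v is shared with one of them, so v would be in
  -- `Core`.
  unique : ∀ {v d e} → ¬ Core v → Core (v ⊕ d) → Core (v ⊕ e) → d ≡ e
  unique {v} {d@(i , s)} {e@(j , s′)} ¬core (x , Tx , p) core-e with i ≟ j
  ... | yes refl with ≡⊎≡opp {i = i} s′ s
  ...   | inj₁ refl = refl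
  ...   | inj₂ refl = contradiction (Core-⊕ v e Tx (Cell-⊕⇒Υ v x d p) core-e) (opposite-∉ v x d p)
  unique {v} {d@(i , s)} {e@(j , s′)} ¬core (x , Tx , p) core-e | no i≢j =
    contradiction (x , Tx , cell) ¬core
    where
    q = Core-⊕ v e Tx (Cell-⊕⇒Υ v x d p) core-e

    cell : IsZeroMinusOneVec (lookup v ⊖ x)
    cell k with k ≟ i
    ... | no k≢i   = subst InCell (lookup-⊖-⊕-≢ v x i s k≢i) (p k)
    ... | yes refl = subst InCell (lookup-⊖-⊕-≢ v x j s′ i≢j) (q k)

  paired : ∀ {v} d → Core v → Core (v ⊕ d) ⊎ Core (v ⊕ opp d)
  paired {v} (i , s) (x , Tx , cell) = Sum.map (core s) (core (opposite s)) (InCell-pair s (cell i))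
    where
    core : ∀ s → InCell ((lookup v ⊖ x) i ℤ.+ unit s) → Core (v ⊕ (i , s))
    core s p = x , Tx , cell-⊕
      where
      cell-⊕ : IsZeroMinusOneVec (lookup (v ⊕ (i , s)) ⊖ x)
      cell-⊕ j with j ≟ i
      ... | no j≢i   = subst InCell (sym (lookup-⊖-⊕-≢ v x i s j≢i)) (cell j)
      ... | yes refl = subst InCell (sym (lookup-⊖-⊕-≡ v x i s)) p

  unpaired : ∀ {v d} → Core v → Core (v ⊕ d) → ¬ Core (v ⊕ opp d)
  unpaired {v} {d} (x , Tx , cell) core core′ =
    opposite-∉ v x d (Core-⊕ v d Tx (Cell⇒Υ cell) core) (Core-⊕ v (opp d) Tx (Cell⇒Υ cell) core′)

  isCubicalCode : IsCubicalCode _⊕_ Core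
  isCubicalCode = record
    { ⊕-comm    = ⊕-comm
    ; ⊕-opp     = ⊕-opp
    ; S?        = Core?
    ; dominated = λ {v} → dominated {v}
    ; unique    = λ {v} → unique {v}
    ; paired    = λ {v} → paired {v}
    ; unpaired  = λ {v} → unpaired {v}
    }

-- The Boolean cube as {0,2}ⁿ, and the conclusion.

double : Bool → ℤ
double b = if b then ℤ.+ 2 else 0ℤ

towards : Bool → Sign
towards b = if b then Sign.- else Sign.+

map-double-flip : ∀ {n} (v : Vec Bool n) i → let d = i , towards (lookup v i) in
  Vec.map double (flip i v) ≡ Vec.map double v ⊕ d ⊕ d
map-double-flip v i = trans (map-updateAt {f = double} v i (toggle (lookup v i))) (sym (updateAt-updateAt i (Vec.map double v)))
  where
  toggle : ∀ b → double (not b) ≡ double b ℤ.+ unit (towards b) ℤ.+ unit (towards b)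
  toggle true  = refl
  toggle false = refl

theorem2 : (n : ℕ) → (T : ℤ^ n → Set) → IsIntegerTiling n T
    → (∃ λ k → n ≡ suc (2 * k))
    → ∃ λ t → (0 < t) × (n ≡ 2 ^ t ∸ 1)
theorem2 n T tiling (k , odd) with ∣2^⇒≡2^ n (suc[n]∣2^n (Vec.map double) (λ v i → towards (lookup v i)) map-double-flip)
  where
  open CubicalCode (Tiling.isCubicalCode tiling)
  open OddDimension k odd
-- The exponent 0 would force n = 0, which is not odd.
... | zero  , suc[n]≡1 = contradiction (trans (sym odd) (ℕ.suc-injective suc[n]≡1)) λ ()
... | suc t , suc[n]≡2^ = suc t , ℕ.z<s , cong (_∸ 1) suc[n]≡2^
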